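{- Let $(a_n)_{n\ge0}$ be given by $a_n=1$ if $n+1$ is a power of $2$ and $a_n=0$ otherwise. Let $m$ and $K\ge0$ be integers with $1\le 2^K<m\le 2^{K+1}$, and for $n\ge0$ let $d(n,m)=\det\left(a_{i+j+m}\right)_{i,j=0}^{n-1}$ (with $d(0,m)=1$). Then $d(n,m)\in\{1,-1\}$ if $n\equiv 0\pmod{2^{K+1}}$ or $n\equiv -m\pmod{2^{K+1}}$, and $d(n,m)=0$ otherwise. -}

module Defs where

open import Data.Bool.Base using (if_then_else_)
open import Data.Fin.Base using (toℕ)
open import Data.Integer.Base as ℤ using (ℤ; 0ℤ; 1ℤ; -1ℤ; +_)
open import Data.Integer.Divisibility using () renaming (_∣_ to _∣ℤ_)
open import Data.Integer.Properties using (+-*-semiring)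
open import Data.Nat.Base using (ℕ; zero; suc; _+_; _^_)
open import Data.Nat.Logarithm using (⌊log₂_⌋; ⌊log₂[2^n]⌋≡n)
open import Data.Nat.Properties using (_≟_)
open import Data.Product.Base using (∃; _,_)
open import Data.Vec.Functional using (Vector; head; tail; map; removeAt)
open import Relation.Binary.PropositionalEquality using (_≡_; refl; cong; sym)
open import Relation.Nullary.Decidable using (Dec; does; map′)

open import Algebra.Properties.Semiring.Sum +-*-semiring using (sum-syntax)

IsPowerOf2 : ℕ → Set
IsPowerOf2 k = ∃ λ e → k ≡ 2 ^ e

isPowerOf2? : ∀ k → Dec (IsPowerOf2 k)
isPowerOf2? k = map′ (⌊log₂ k ⌋ ,_) exponent≡log (k ≟ 2 ^ ⌊log₂ k ⌋)
  where
  exponent≡log : IsPowerOf2 k → k ≡ 2 ^ ⌊log₂ k ⌋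
  exponent≡log (e , refl) = cong (2 ^_) (sym (⌊log₂[2^n]⌋≡n e))

a : ℕ → ℤ
a n = if does (isPowerOf2? (suc n)) then 1ℤ else 0ℤ

Matrix : ℕ → Set
Matrix n = Vector (Vector ℤ n) n

-- Laplace expansion along the first row.  The empty determinant is 1.
det : ∀ {n} → Matrix n → ℤ
det {zero}  M = 1ℤ
det {suc n} M =
  ∑[ j < suc n ] (-1ℤ ℤ.^ toℕ j ℤ.* head M j ℤ.* det (map (λ row → removeAt row j) (tail M)))

d : ℕ → ℕ → ℤ
d n m = det {n} (λ i j → a (toℕ i + toℕ j + m))

infix 4 _≡_[mod_]

_≡_[mod_] : ℤ → ℤ → ℕ → Set
x ≡ y [mod N ] = + N ∣ℤ (x ℤ.- y)

{-# OPTIONS --safe #-}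
-- For n ≥ 1, at most one power 2 ^ e lies in the range n + m , … , 2n + m - 1
-- of the values i + j + m + 1 along the last row, so this
-- row has at most one nonzero entry; if it has none, the determinant is 0 and, as
-- multiples of 2 ^ (K + 1) are too sparse, n is in neither of the two classes.
-- Otherwise the last row and the last column (the matrix is symmetric) can be
-- expanded along their single nonzero entry, and the same power 2 ^ e governs the
-- last row of the matrix that remains.  Iterating, the whole anti-diagonal
-- i + j + m + 1 = 2 ^ e is stripped off, together with all indices ≥ p, where
-- p + n + m = 2 ^ e.  Hence d n m = ± d p m, and since 2 ^ (K + 1) divides 2 ^ e,
-- the map n ↦ p exchanges the residue classes of 0 and - m.
module Submission where

open import Defs
open import Data.Integer.Base using (+_; -_; 0ℤ; 1ℤ; -1ℤ)
open import Data.Nat.Base using (ℕ; suc; _^_; _≤_; _<_)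
open import Data.Product.Base using (_×_)
open import Data.Sum.Base using (_⊎_)
open import Relation.Binary.PropositionalEquality using (_≡_)
open import Relation.Nullary.Negation using (¬_)

open import Data.Bool.Base using (if_then_else_)
open import Data.Fin.Base as Fin using (Fin; toℕ; fromℕ; fromℕ<; punchIn; pinch)
open import Data.Fin.Properties using (punchIn-injective; punchInᵢ≢i; toℕ<n; toℕ-fromℕ; toℕ-fromℕ<; toℕ-injective) renaming (suc-injective to Fin-suc-injective)
open import Data.Integer.Base as ℤ using (ℤ)
import Data.Integer.Properties as ℤ
open import Data.Integer.Tactic.RingSolver renaming (solve-∀ to solve-∀ℤ)
open import Data.Nat.Base using (zero; pred; _+_; _*_; z≤n; s≤s; z<s; s<s; NonZero; >-nonZero)
open import Data.Nat.Divisibility using (_∣_; divides-refl; ∣⇒≤; ∣m+n∣m⇒∣n; m∣m*n; _∣0)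
open import Data.Nat.Induction using (<-rec)
open import Data.Nat.Properties
open import Data.Nat.Tactic.RingSolver using (solve-∀)
open import Data.Product.Base using (∃; _,_; proj₁; proj₂)
open import Data.Sum.Base as Sum using (inj₁; inj₂; [_,_]′)
open import Data.Vec.Functional using (Vector; removeAt)
open import Function.Base using (_∘_)
open import Relation.Binary.PropositionalEquality using (_≢_; _≗_; refl; sym; trans; cong; cong₂; subst; subst₂; module ≡-Reasoning)
open import Relation.Nullary.Decidable using (yes; no; dec-true; dec-false)
open import Relation.Nullary.Negation using (contradiction)

open import Algebra.Properties.Semiring.Sum ℤ.+-*-semiring using (sum; sum-remove; sum-cong-≗; sum-replicate-zero; *-distribˡ-sum)

private variable
  n : ℕ

-- Equality up to sign

infix 4 _≈±_

_≈±_ : ℤ → ℤ → Set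
x ≈± y = x ≡ y ⊎ x ≡ - y

≈±-trans : ∀ {x y z} → x ≈± y → y ≈± z → x ≈± z
≈±-trans (inj₁ refl) y≈z         = y≈z
≈±-trans (inj₂ refl) (inj₁ refl) = inj₂ refl
≈±-trans (inj₂ refl) (inj₂ refl) = inj₁ (ℤ.neg-involutive _)

-1^k*-≈± : ∀ k x → -1ℤ ℤ.^ k ℤ.* x ≈± x
-1^k*-≈± zero    x = inj₁ (ℤ.*-identityˡ x)
-1^k*-≈± (suc k) x = ≈±-trans (inj₂ (step (-1ℤ ℤ.^ k) x)) (-1^k*-≈± k x)
  where
  step : ∀ y x → -1ℤ ℤ.* y ℤ.* x ≡ - (y ℤ.* x)
  step = solve-∀ℤ

-- Determinants

minor : Fin (suc n) → Fin (suc n) → Matrix (suc n) → Matrix n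
minor i j M r c = M (punchIn i r) (punchIn j c)

sum-zero : (t : Vector ℤ n) → (∀ k → t k ≡ 0ℤ) → sum t ≡ 0ℤ
sum-zero {n} t t≡0 = trans (sum-cong-≗ t≡0) (sum-replicate-zero n)

det-cong : {M N : Matrix n} → (∀ i j → M i j ≡ N i j) → det M ≡ det N
det-cong {zero}  M≡N = refl
det-cong {suc n} M≡N = sum-cong-≗ λ j →
  cong₂ (λ x y → -1ℤ ℤ.^ toℕ j ℤ.* x ℤ.* y) (M≡N Fin.zero j)
    (det-cong λ r c → M≡N (Fin.suc r) (punchIn j c))

-- Deleting column punchIn j k first moves column j to position pinch k j.
punchIn-pinch : (j : Fin (suc (suc n))) (k : Fin (suc n)) → punchIn (punchIn j k) (pinch k j) ≡ j
punchIn-pinch         Fin.zero    k           = refl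
punchIn-pinch         (Fin.suc j) Fin.zero    = refl
punchIn-pinch {suc n} (Fin.suc j) (Fin.suc k) = cong Fin.suc (punchIn-pinch j k)

-- Both sides list the columns other than `j` and `punchIn j k`, with the two deletions made in
-- opposite orders.
punchIn-comm : (j : Fin (suc (suc n))) (k : Fin (suc n)) (c : Fin n) →
               punchIn (punchIn j k) (punchIn (pinch k j) c) ≡ punchIn j (punchIn k c)
punchIn-comm Fin.zero    k           c           = refl
punchIn-comm (Fin.suc j) Fin.zero    c           = refl
punchIn-comm (Fin.suc j) (Fin.suc k) Fin.zero    = refl
punchIn-comm (Fin.suc j) (Fin.suc k) (Fin.suc c) = cong Fin.suc (punchIn-comm j k c)

-- Exchanging the order of two deletions shifts exactly one of the two positions by one:
-- `punchIn j k` and `pinch k j` add up to `j + k + 1` or `j + k - 1`.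
sign-pinch : (j : Fin (suc (suc n))) (k : Fin (suc n)) →
             -1ℤ ℤ.^ toℕ (punchIn j k) ℤ.* -1ℤ ℤ.^ toℕ (pinch k j) ≡
             -1ℤ ℤ.* (-1ℤ ℤ.^ toℕ j ℤ.* -1ℤ ℤ.^ toℕ k)
sign-pinch Fin.zero k = solve-zero (-1ℤ ℤ.^ toℕ k)
  where
  solve-zero : ∀ x → -1ℤ ℤ.* x ℤ.* 1ℤ ≡ -1ℤ ℤ.* (1ℤ ℤ.* x)
  solve-zero = solve-∀ℤ
sign-pinch (Fin.suc j) Fin.zero = solve-zero (-1ℤ ℤ.^ toℕ j)
  where
  solve-zero : ∀ x → 1ℤ ℤ.* x ≡ -1ℤ ℤ.* (-1ℤ ℤ.* x ℤ.* 1ℤ)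
  solve-zero = solve-∀ℤ
sign-pinch {suc n} (Fin.suc j) (Fin.suc k) =
  trans (double (-1ℤ ℤ.^ toℕ (punchIn j k)) (-1ℤ ℤ.^ toℕ (pinch k j)))
    (trans (sign-pinch j k) (sym (cong (-1ℤ ℤ.*_) (double (-1ℤ ℤ.^ toℕ j) (-1ℤ ℤ.^ toℕ k)))))
  where
  double : ∀ x y → -1ℤ ℤ.* x ℤ.* (-1ℤ ℤ.* y) ≡ x ℤ.* y
  double = solve-∀ℤ

-- Both alternatives pass to the minors of a first-row expansion, so expansion along a row and along
-- a column can share one induction.
Pivot : Matrix (suc n) → Fin (suc n) → Fin (suc n) → Set
Pivot M i j = (∀ k → k ≢ j → M i k ≡ 0ℤ) ⊎ (∀ r → r ≢ i → M r j ≡ 0ℤ)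

-- Induction on `i`. For `i = 0` only the term `j` of the defining sum survives. Below the first row
-- the term `j` vanishes, and every other minor has a pivot again, one row higher and in column
-- `pinch k j`.
det-pivot : (M : Matrix (suc n)) (i j : Fin (suc n)) → Pivot M i j →
            det M ≡ -1ℤ ℤ.^ toℕ i ℤ.* -1ℤ ℤ.^ toℕ j ℤ.* M i j ℤ.* det (minor i j M)

-- Mutually recursive with `det-pivot`, which needs it one size lower for minors with a zero row or
-- column.
det-zero : (M : Matrix (suc n)) (i j : Fin (suc n)) → Pivot M i j → M i j ≡ 0ℤ → det M ≡ 0ℤ
det-zero M i j pivot Mij≡0 = begin
  det M                                    ≡⟨ det-pivot M i j pivot ⟩
  s ℤ.* M i j ℤ.* det (minor i j M)        ≡⟨ cong (λ x → s ℤ.* x ℤ.* det (minor i j M)) Mij≡0 ⟩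
  s ℤ.* 0ℤ ℤ.* det (minor i j M)           ≡⟨ vanish s (det (minor i j M)) ⟩
  0ℤ                                       ∎
  where
  open ≡-Reasoning
  s = -1ℤ ℤ.^ toℕ i ℤ.* -1ℤ ℤ.^ toℕ j
  vanish : ∀ x y → x ℤ.* 0ℤ ℤ.* y ≡ 0ℤ
  vanish = solve-∀ℤ

det-pivot {n} M Fin.zero j pivot = begin
  det M                                          ≡⟨ sum-remove {i = j} t ⟩
  t j ℤ.+ sum (removeAt t j)        ≡⟨ cong (λ x → t j ℤ.+ x) (sum-zero _ (others pivot)) ⟩
  t j ℤ.+ 0ℤ                                     ≡⟨ tidy (-1ℤ ℤ.^ toℕ j) (M Fin.zero j) (det (minor Fin.zero j M)) ⟩
  1ℤ ℤ.* -1ℤ ℤ.^ toℕ j ℤ.* M Fin.zero j ℤ.* det (minor Fin.zero j M) ∎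
  where
  open ≡-Reasoning
  t : Vector ℤ (suc n)
  t k = -1ℤ ℤ.^ toℕ k ℤ.* M Fin.zero k ℤ.* det (minor Fin.zero k M)
  tidy : ∀ x y z → x ℤ.* y ℤ.* z ℤ.+ 0ℤ ≡ 1ℤ ℤ.* x ℤ.* y ℤ.* z
  tidy = solve-∀ℤ
  vanish : ∀ x y → x ℤ.* 0ℤ ℤ.* y ≡ 0ℤ
  vanish = solve-∀ℤ
  zero-column : ∀ {n} (M : Matrix (suc n)) j (k : Fin n) → (∀ r → r ≢ Fin.zero → M r j ≡ 0ℤ) →
                det (minor Fin.zero (punchIn j k) M) ≡ 0ℤ
  -- All rows of the minor come from below row `0` of `M`, so its column `pinch k j` is entirely
  -- zero; its row `0` is an arbitrary choice.
  zero-column {suc _} M j k col = det-zero (minor Fin.zero (punchIn j k) M) Fin.zero (pinch k j) (inj₂ λ r _ → column r) (column Fin.zero)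
    where
    column : ∀ r → minor Fin.zero (punchIn j k) M r (pinch k j) ≡ 0ℤ
    column r = trans (cong (M (Fin.suc r)) (punchIn-pinch j k)) (col (Fin.suc r) λ ())
  others : Pivot M Fin.zero j → ∀ k → t (punchIn j k) ≡ 0ℤ
  others (inj₁ row) k = trans
    (cong (λ x → -1ℤ ℤ.^ toℕ (punchIn j k) ℤ.* x ℤ.* det (minor Fin.zero (punchIn j k) M))
      (row (punchIn j k) (punchInᵢ≢i j k)))
    (vanish (-1ℤ ℤ.^ toℕ (punchIn j k)) _)
  others (inj₂ col) k = trans
    (cong (-1ℤ ℤ.^ toℕ (punchIn j k) ℤ.* M Fin.zero (punchIn j k) ℤ.*_) (zero-column M j k col))
    (ℤ.*-zeroʳ (-1ℤ ℤ.^ toℕ (punchIn j k) ℤ.* M Fin.zero (punchIn j k)))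
det-pivot {suc n} M (Fin.suc i) j pivot = begin
  det M                                                      ≡⟨ sum-remove {i = j} t ⟩
  t j ℤ.+ sum (removeAt t j)                    ≡⟨ cong₂ ℤ._+_ (tj≡0 pivot) (sum-cong-≗ others) ⟩
  0ℤ ℤ.+ sum (λ k → s ℤ.* t′ k)                 ≡⟨ ℤ.+-identityˡ _ ⟩
  sum (λ k → s ℤ.* t′ k)                        ≡⟨ *-distribˡ-sum s t′ ⟨
  s ℤ.* det (minor (Fin.suc i) j M)                          ∎
  where
  open ≡-Reasoning
  s : ℤ
  s = -1ℤ ℤ.* -1ℤ ℤ.^ toℕ i ℤ.* -1ℤ ℤ.^ toℕ j ℤ.* M (Fin.suc i) j
  t : Vector ℤ (suc (suc n))
  t k = -1ℤ ℤ.^ toℕ k ℤ.* M Fin.zero k ℤ.* det (minor Fin.zero k M)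
  t′ : Vector ℤ (suc n)
  t′ k = -1ℤ ℤ.^ toℕ k ℤ.* M Fin.zero (punchIn j k) ℤ.* det (minor Fin.zero k (minor (Fin.suc i) j M))
  vanish : ∀ x y → x ℤ.* 0ℤ ℤ.* y ≡ 0ℤ
  vanish = solve-∀ℤ
  tj≡0 : Pivot M (Fin.suc i) j → t j ≡ 0ℤ
  tj≡0 (inj₁ row) = trans
    (cong (-1ℤ ℤ.^ toℕ j ℤ.* M Fin.zero j ℤ.*_)
      -- Row `i` of this minor is row `i + 1` of `M` without its entry in column `j`, hence zero;
      -- the second `i` is an arbitrary column.
      (det-zero (minor Fin.zero j M) i i (inj₁ λ k _ → zero-row k) (zero-row i)))
    (ℤ.*-zeroʳ (-1ℤ ℤ.^ toℕ j ℤ.* M Fin.zero j))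
    where
    zero-row : ∀ k → minor Fin.zero j M i k ≡ 0ℤ
    zero-row k = row (punchIn j k) (punchInᵢ≢i j k)
  tj≡0 (inj₂ col) = trans
    (cong (λ x → -1ℤ ℤ.^ toℕ j ℤ.* x ℤ.* det (minor Fin.zero j M)) (col Fin.zero λ ()))
    (vanish (-1ℤ ℤ.^ toℕ j) _)
  inherited : Pivot M (Fin.suc i) j → ∀ k → Pivot (minor Fin.zero (punchIn j k) M) i (pinch k j)
  inherited (inj₁ row) k = inj₁ λ c c≢ → row _ λ eq →
    c≢ (punchIn-injective (punchIn j k) c (pinch k j) (trans eq (sym (punchIn-pinch j k))))
  inherited (inj₂ col) k = inj₂ λ r r≢ →
    trans (cong (M (Fin.suc r)) (punchIn-pinch j k)) (col (Fin.suc r) (r≢ ∘ Fin-suc-injective))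
  regroup : ∀ α β γ δ ε x y z → α ℤ.* β ≡ -1ℤ ℤ.* (γ ℤ.* δ) →
            α ℤ.* x ℤ.* (ε ℤ.* β ℤ.* y ℤ.* z) ≡ -1ℤ ℤ.* ε ℤ.* γ ℤ.* y ℤ.* (δ ℤ.* x ℤ.* z)
  regroup α β γ δ ε x y z eq = begin
    α ℤ.* x ℤ.* (ε ℤ.* β ℤ.* y ℤ.* z)                ≡⟨ collect α β ε x y z ⟩
    α ℤ.* β ℤ.* (ε ℤ.* x ℤ.* y ℤ.* z)                ≡⟨ cong (ℤ._* (ε ℤ.* x ℤ.* y ℤ.* z)) eq ⟩
    -1ℤ ℤ.* (γ ℤ.* δ) ℤ.* (ε ℤ.* x ℤ.* y ℤ.* z)      ≡⟨ distribute γ δ ε x y z ⟩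
    -1ℤ ℤ.* ε ℤ.* γ ℤ.* y ℤ.* (δ ℤ.* x ℤ.* z)        ∎
    where
    collect : ∀ α β ε x y z → α ℤ.* x ℤ.* (ε ℤ.* β ℤ.* y ℤ.* z) ≡ α ℤ.* β ℤ.* (ε ℤ.* x ℤ.* y ℤ.* z)
    collect = solve-∀ℤ
    distribute : ∀ γ δ ε x y z → -1ℤ ℤ.* (γ ℤ.* δ) ℤ.* (ε ℤ.* x ℤ.* y ℤ.* z) ≡ -1ℤ ℤ.* ε ℤ.* γ ℤ.* y ℤ.* (δ ℤ.* x ℤ.* z)
    distribute = solve-∀ℤ
  others : ∀ k → t (punchIn j k) ≡ s ℤ.* t′ k
  others k = begin
    α ℤ.* x ℤ.* det M₀                                              ≡⟨ cong (α ℤ.* x ℤ.*_) (det-pivot M₀ i j′ (inherited pivot k)) ⟩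
    α ℤ.* x ℤ.* (ε ℤ.* β ℤ.* M₀ i j′ ℤ.* det (minor i j′ M₀))       ≡⟨ cong₂ (λ y z → α ℤ.* x ℤ.* (ε ℤ.* β ℤ.* y ℤ.* z))
                                                                        (cong (M (Fin.suc i)) (punchIn-pinch j k))
                                                                        (det-cong λ r c → cong (M (Fin.suc (punchIn i r))) (punchIn-comm j k c)) ⟩
    α ℤ.* x ℤ.* (ε ℤ.* β ℤ.* M (Fin.suc i) j ℤ.* det M₁)            ≡⟨ regroup α β _ (-1ℤ ℤ.^ toℕ k) ε x (M (Fin.suc i) j) (det M₁) (sign-pinch j k) ⟩
    s ℤ.* t′ k                                                      ∎
    where
    j′ = pinch k j
    M₀ = minor Fin.zero (punchIn j k) M
    M₁ = minor Fin.zero k (minor (Fin.suc i) j M)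
    α = -1ℤ ℤ.^ toℕ (punchIn j k)
    β = -1ℤ ℤ.^ toℕ j′
    ε = -1ℤ ℤ.^ toℕ i
    x = M Fin.zero (punchIn j k)

det-unit-pivot : (M : Matrix (suc n)) (i j : Fin (suc n)) → Pivot M i j → M i j ≡ 1ℤ →
                 det M ≈± det (minor i j M)
det-unit-pivot M i j pivot Mij≡1 =
  subst (_≈± D) (sym eq) (≈±-trans (-1^k*-≈± (toℕ i) _) (-1^k*-≈± (toℕ j) D))
  where
  D = det (minor i j M)
  tidy : ∀ x y z → x ℤ.* y ℤ.* 1ℤ ℤ.* z ≡ x ℤ.* (y ℤ.* z)
  tidy = solve-∀ℤ
  eq : det M ≡ -1ℤ ℤ.^ toℕ i ℤ.* (-1ℤ ℤ.^ toℕ j ℤ.* D)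
  eq = trans (det-pivot M i j pivot)
    (trans (cong (λ x → -1ℤ ℤ.^ toℕ i ℤ.* -1ℤ ℤ.^ toℕ j ℤ.* x ℤ.* D) Mij≡1)
      (tidy (-1ℤ ℤ.^ toℕ i) (-1ℤ ℤ.^ toℕ j) D))

-- Powers of two

1≤2^ : ∀ e → 1 ≤ 2 ^ e
1≤2^ = m^n>0 2

2^-cancel-< : ∀ e f → 2 ^ e < 2 ^ f → e < f
2^-cancel-< e f 2^e<2^f with e <? f
... | yes e<f = e<f
... | no  e≮f = contradiction 2^e<2^f (≤⇒≯ (^-monoʳ-≤ 2 (≮⇒≥ e≮f)))

2^-∣ : ∀ {i e} → i ≤ e → 2 ^ i ∣ 2 ^ e
2^-∣ {i} i≤e with k , refl ← m≤n⇒∃[o]m+o≡n i≤e =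
  subst (2 ^ i ∣_) (sym (^-distribˡ-+-* 2 i k)) (m∣m*n (2 ^ k))

-- Induction on `x`: the exponent is raised only when `2 ^ e` falls below the new bound. Applied to
-- `n + m`, it yields the only power of two that can occur in the last row for `d n m`.
2^-between : ∀ x → 1 ≤ x → ∃ λ e → x ≤ 2 ^ e × 2 ^ e < 2 * x
2^-between 1             _ = 0 , s≤s z≤n , s≤s (s≤s z≤n)
2^-between (suc x@(suc _)) _ with 2^-between x (s≤s z≤n)
... | e , x≤2^e , 2^e<2x with suc x ≤? 2 ^ e
...   | yes x<2^e = e , x<2^e , <-≤-trans 2^e<2x (*-monoʳ-≤ 2 (n≤1+n x))
...   | no  x≮2^e = suc e , s≤2^ , ≤-<-trans (*-monoʳ-≤ 2 2^e≤x) (*-monoʳ-< 2 (n<1+n x))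
  where
  2^e≤x : 2 ^ e ≤ x
  2^e≤x = ≤-pred (≰⇒> x≮2^e)
  s≤2^ : suc x ≤ 2 ^ suc e
  s≤2^ = ≤-trans (+-mono-≤ (1≤2^ e) x≤2^e) (+-monoʳ-≤ (2 ^ e) (m≤m+n (2 ^ e) 0))

∣∧<⇒+≤ : ∀ {k x y} → k ∣ x → k ∣ y → x < y → x + k ≤ y
∣∧<⇒+≤ {k} (divides-refl q) (divides-refl r) qk<rk =
  subst (_≤ r * k) (+-comm k (q * k)) (*-monoˡ-≤ k (*-cancelʳ-< k q r qk<rk))

a-power : ∀ {x} → IsPowerOf2 (suc x) → a x ≡ 1ℤ
a-power {x} p = cong (if_then 1ℤ else 0ℤ) (dec-true (isPowerOf2? (suc x)) p)

a-nonpower : ∀ {x} → ¬ IsPowerOf2 (suc x) → a x ≡ 0ℤ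
a-nonpower {x} ¬p = cong (if_then 1ℤ else 0ℤ) (dec-false (isPowerOf2? (suc x)) ¬p)

-- Stripping off the anti-diagonal

-- Rows and columns carry separate index vectors, so that minors stay in the family: deleting a row
-- or a column is, definitionally, `removeAt` on its vector.
hankel : ℕ → Vector ℕ n → Vector ℕ n → Matrix n
hankel m x y i j = a (x i + y j + m)

Injectiveᵛ : Vector ℕ n → Set
Injectiveᵛ x = ∀ {i j} → x i ≡ x j → i ≡ j

removeAt-injective : (x : Vector ℕ (suc n)) (i : Fin (suc n)) → Injectiveᵛ x → Injectiveᵛ (removeAt x i)
removeAt-injective x i inj = punchIn-injective i _ _ ∘ inj

-- Two different powers of two differ by a factor of at least 2, but both
-- w + v + m + 1 and w + x + m + 1 lie between w + m + 1 and 2 * w + m + 1.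
2^-unique-in-line : ∀ {m w v x} → 1 ≤ m → v ≤ w → x ≤ w →
                    IsPowerOf2 (suc (w + v + m)) → IsPowerOf2 (suc (w + x + m)) → x ≡ v
2^-unique-in-line {m} {w} {v} {x} 1≤m v≤w x≤w (e , eqᵉ) (f , eqᶠ) =
  +-cancelˡ-≡ w x v (+-cancelʳ-≡ m (w + x) (w + v)
    (cong pred (trans eqᶠ (trans (cong (2 ^_) (sym e≡f)) (sym eqᵉ)))))
  where
  below-double : ∀ {y z} → y ≤ w → suc (w + y + m) < 2 * suc (w + z + m)
  below-double {y} {z} y≤w = begin-strict
    suc (w + y + m)            ≤⟨ s≤s (+-monoˡ-≤ m (+-monoʳ-≤ w y≤w)) ⟩
    suc (w + w + m)            <⟨ n<1+n _ ⟩
    2 + (w + w + m)            ≤⟨ m≤m+n _ (z + z + m) ⟩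
    2 + (w + w + m) + (z + z + m) ≡⟨ rearrange w z m ⟩
    2 * suc (w + z + m)        ∎
    where
    open ≤-Reasoning
    rearrange : ∀ w z m → 2 + (w + w + m) + (z + z + m) ≡ 2 * suc (w + z + m)
    rearrange = solve-∀
  exponent-≤ : ∀ g h {y z} → y ≤ w → suc (w + y + m) ≡ 2 ^ g → suc (w + z + m) ≡ 2 ^ h → g ≤ h
  exponent-≤ g h y≤w eqᵍ eqʰ = ≤-pred (2^-cancel-< g (suc h) (subst₂ _<_ eqᵍ (cong (2 *_) eqʰ) (below-double y≤w)))
  e≡f : e ≡ f
  e≡f = ≤-antisym (exponent-≤ e f v≤w eqᵉ eqᶠ) (exponent-≤ f e x≤w eqᶠ eqᵉ)

module _ {m : ℕ} (1≤m : 1 ≤ m) where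

  -- As `x i` bounds every `y k`, only one power of two can occur along row `i`; injectivity of `y`
  -- confines it to column `j`.
  det-hankel-row : ∀ (x y : Vector ℕ (suc n)) i j → Injectiveᵛ y → (∀ k → y k ≤ x i) →
                   IsPowerOf2 (suc (x i + y j + m)) →
                   det (hankel m x y) ≈± det (hankel m (removeAt x i) (removeAt y j))
  det-hankel-row x y i j inj y≤xi power =
    det-unit-pivot (hankel m x y) i j (inj₁ row) (a-power power)
    where
    row : ∀ k → k ≢ j → a (x i + y k + m) ≡ 0ℤ
    row k k≢j = a-nonpower λ power′ →
      k≢j (inj (2^-unique-in-line 1≤m (y≤xi j) (y≤xi k) power power′))

  det-hankel-column : ∀ (x y : Vector ℕ (suc n)) i j → Injectiveᵛ x → (∀ k → x k ≤ y j) →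
                      IsPowerOf2 (suc (x i + y j + m)) →
                      det (hankel m x y) ≈± det (hankel m (removeAt x i) (removeAt y j))
  det-hankel-column x y i j inj x≤yj power =
    det-unit-pivot (hankel m x y) i j (inj₂ column) (a-power power)
    where
    swap : ∀ k → suc (x k + y j + m) ≡ suc (y j + x k + m)
    swap k = cong (λ s → suc (s + m)) (+-comm (x k) (y j))
    column : ∀ k → k ≢ i → a (x k + y j + m) ≡ 0ℤ
    column k k≢i = a-nonpower λ power′ →
      k≢i (inj (2^-unique-in-line 1≤m (x≤yj i) (x≤yj k)
        (subst IsPowerOf2 (swap i) power) (subst IsPowerOf2 (swap k) power′)))

-- gap p t enumerates ℕ ∖ {p , … , p + t - 1}.
gap : ℕ → ℕ → ℕ → ℕ
gap zero    t i       = t + i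
gap (suc p) t zero    = zero
gap (suc p) t (suc i) = suc (gap p t i)

gap-< : ∀ {p i} t → i < p → gap p t i ≡ i
gap-< t z<s              = refl
gap-< t (s<s i<p@(s≤s _)) = cong suc (gap-< t i<p)

gap-+ : ∀ p t k → gap p t (p + k) ≡ p + (t + k)
gap-+ zero    t k = refl
gap-+ (suc p) t k = cong suc (gap-+ p t k)

gap-0 : ∀ p i → gap p 0 i ≡ i
gap-0 zero    i       = refl
gap-0 (suc p) zero    = refl
gap-0 (suc p) (suc i) = cong suc (gap-0 p i)

-- Position `p` of the enumeration holds `p + t`, the first value above the gap; skipping it widens
-- the gap by one.
gap-gap : ∀ p t i → gap p t (gap p 1 i) ≡ gap p (suc t) i
gap-gap zero    t i       = +-suc t i
gap-gap (suc p) t zero    = refl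
gap-gap (suc p) t (suc i) = cong suc (gap-gap p t i)

gap-mono : ∀ p t {i j} → i ≤ j → gap p t i ≤ gap p t j
gap-mono zero    t i≤j       = +-monoʳ-≤ t i≤j
gap-mono (suc p) t z≤n       = z≤n
gap-mono (suc p) t (s≤s i≤j) = s≤s (gap-mono p t i≤j)

gap-injective : ∀ p t {i j} → gap p t i ≡ gap p t j → i ≡ j
gap-injective zero    t                 eq = +-cancelˡ-≡ t _ _ eq
gap-injective (suc p) t {zero}  {zero}  eq = refl
gap-injective (suc p) t {suc _} {suc _} eq = cong suc (gap-injective p t (suc-injective eq))

toℕ-punchIn : (i : Fin (suc n)) (c : Fin n) → toℕ (punchIn i c) ≡ gap (toℕ i) 1 (toℕ c)
toℕ-punchIn Fin.zero    c           = refl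
toℕ-punchIn (Fin.suc i) Fin.zero    = refl
toℕ-punchIn (Fin.suc i) (Fin.suc c) = cong suc (toℕ-punchIn i c)

toℕ-punchIn-fromℕ : (c : Fin n) → toℕ (punchIn (fromℕ n) c) ≡ toℕ c
toℕ-punchIn-fromℕ {n} c = trans (toℕ-punchIn (fromℕ n) c)
  (gap-< 1 (subst (toℕ c <_) (sym (toℕ-fromℕ n)) (toℕ<n c)))

gapᵛ : ℕ → ℕ → Vector ℕ n
gapᵛ p t i = gap p t (toℕ i)

gapᵛ-injective : ∀ p t → Injectiveᵛ (gapᵛ {n} p t)
gapᵛ-injective p t eq = toℕ-injective (gap-injective p t eq)

det-hankel-cong : ∀ {n} m {x x′ y y′ : Vector ℕ n} → x ≗ x′ → y ≗ y′ →
                  det (hankel m x y) ≡ det (hankel m x′ y′)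
det-hankel-cong m x≗x′ y≗y′ = det-cong λ i j → cong₂ (λ s t → a (s + t + m)) (x≗x′ i) (y≗y′ j)

-- The remaining indices are `0, ..., p - 1` and a block `p + t, ..., p + t + q - 1`. If the block
-- is not empty, the hypothesis says that its smallest and largest index meet in the value `2 ^ e`.
-- Removing both lowers `q` by two and raises `t` by one, which preserves the hypothesis. The size
-- is written `q + p` so that it computes when `q` is matched.
strip : ∀ {m} → 1 ≤ m → ∀ p q t e → 2 * p + 2 * t + q + m ≡ 2 ^ e →
        det (hankel {q + p} m (gapᵛ p t) (gapᵛ p t)) ≈± d p m
strip {m} 1≤m p zero t e eq =
  inj₁ (det-hankel-cong {p} m (λ i → gap-< t (toℕ<n i)) (λ i → gap-< t (toℕ<n i)))
strip {m} 1≤m p 1 t e eq = ≈±-trans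
  -- A single index `p + t` is left above the gap; the pivot is its diagonal entry.
  (det-hankel-row 1≤m u u last last (gapᵛ-injective p t) u≤ (e , pivot))
  (inj₁ (det-hankel-cong m rest rest))
  where
  u : Vector ℕ (suc p)
  u = gapᵛ p t
  last : Fin (suc p)
  last = fromℕ p
  u-last : u last ≡ p + t
  u-last = trans (cong (gap p t) (trans (toℕ-fromℕ p) (sym (+-identityʳ p))))
    (trans (gap-+ p t 0) (cong (λ s → p + s) (+-identityʳ t)))
  u≤ : ∀ k → u k ≤ u last
  u≤ k = gap-mono p t (subst (toℕ k ≤_) (sym (toℕ-fromℕ p)) (≤-pred (toℕ<n k)))
  pivot : suc (u last + u last + m) ≡ 2 ^ e
  pivot = trans (cong (λ s → suc (s + s + m)) u-last) (trans (arith p t m) eq)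
    where
    arith : ∀ p t m → suc (p + t + (p + t) + m) ≡ 2 * p + 2 * t + 1 + m
    arith = solve-∀
  rest : ∀ i → removeAt u last i ≡ toℕ i
  rest i = trans (cong (gap p t) (toℕ-punchIn-fromℕ i)) (gap-< t (toℕ<n i))
strip {m} 1≤m p (suc (suc q)) t e eq = ≈±-trans
  (det-hankel-row 1≤m u u last₁ mid₁ (gapᵛ-injective p t) u≤ (e , pivot₁))
  (≈±-trans
    -- The second pivot lies in row `p + t`, which is not the largest index, so uniqueness of the
    -- power is used along the column of the largest one.
    (det-hankel-column 1≤m (removeAt u last₁) (removeAt u mid₁) mid₂ last₂
      (removeAt-injective u last₁ (gapᵛ-injective p t)) x≤ (e , pivot₂))
    (subst (_≈± d p m) (sym (det-hankel-cong m rest-rows rest-columns))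
      (strip 1≤m p q (suc t) e (trans (arith p t q m) eq))))
  where
  arith : ∀ p t q m → 2 * p + 2 * suc t + q + m ≡ 2 * p + 2 * t + suc (suc q) + m
  arith = solve-∀
  u : Vector ℕ (suc (suc (q + p)))
  u = gapᵛ p t
  p< : p < suc (q + p)
  p< = s≤s (m≤n+m p q)
  last₁ mid₁ : Fin (suc (suc (q + p)))
  last₁ = fromℕ (suc (q + p))
  mid₁  = fromℕ< (m<n⇒m<1+n p<)
  last₂ mid₂ : Fin (suc (q + p))
  last₂ = fromℕ (q + p)
  mid₂  = fromℕ< p<
  toℕ-last₁ : toℕ last₁ ≡ suc (q + p)
  toℕ-last₁ = toℕ-fromℕ (suc (q + p))
  toℕ-mid₁ : toℕ mid₁ ≡ p
  toℕ-mid₁ = toℕ-fromℕ< (m<n⇒m<1+n p<)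
  punchIn-mid₁ : ∀ c → toℕ (punchIn mid₁ c) ≡ gap p 1 (toℕ c)
  punchIn-mid₁ c = trans (toℕ-punchIn mid₁ c) (cong (λ s → gap s 1 (toℕ c)) toℕ-mid₁)
  punchIn-mid₂ : ∀ c → toℕ (punchIn mid₂ c) ≡ gap p 1 (toℕ c)
  punchIn-mid₂ c = trans (toℕ-punchIn mid₂ c) (cong (λ s → gap s 1 (toℕ c)) (toℕ-fromℕ< p<))
  gap-last : ∀ s → gap p s (q + p) ≡ p + (s + q)
  gap-last s = trans (cong (gap p s) (+-comm q p)) (gap-+ p s q)
  gap-p : gap p t p ≡ p + t
  gap-p = trans (cong (gap p t) (sym (+-identityʳ p)))
    (trans (gap-+ p t 0) (cong (λ s → p + s) (+-identityʳ t)))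
  u-last : u last₁ ≡ p + (suc t + q)
  u-last = begin
    gap p t (toℕ last₁)       ≡⟨ cong (gap p t) (trans toℕ-last₁ (trans (cong suc (+-comm q p)) (sym (+-suc p q)))) ⟩
    gap p t (p + suc q)       ≡⟨ gap-+ p t (suc q) ⟩
    p + (t + suc q)           ≡⟨ cong (λ s → p + s) (+-suc t q) ⟩
    p + (suc t + q)           ∎
    where open ≡-Reasoning
  u-mid : u mid₁ ≡ p + t
  u-mid = trans (cong (gap p t) toℕ-mid₁) gap-p
  x-mid : removeAt u last₁ mid₂ ≡ p + t
  x-mid = trans (cong (gap p t) (trans (toℕ-punchIn-fromℕ mid₂) (toℕ-fromℕ< p<))) gap-p
  y-last : removeAt u mid₁ last₂ ≡ p + (suc t + q)
  y-last = begin
    gap p t (toℕ (punchIn mid₁ last₂))  ≡⟨ cong (gap p t) (punchIn-mid₁ last₂) ⟩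
    gap p t (gap p 1 (toℕ last₂))       ≡⟨ gap-gap p t (toℕ last₂) ⟩
    gap p (suc t) (toℕ last₂)           ≡⟨ cong (gap p (suc t)) (toℕ-fromℕ (q + p)) ⟩
    gap p (suc t) (q + p)               ≡⟨ gap-last (suc t) ⟩
    p + (suc t + q)                     ∎
    where open ≡-Reasoning
  u≤ : ∀ k → u k ≤ u last₁
  u≤ k = gap-mono p t (subst (toℕ k ≤_) (sym toℕ-last₁) (≤-pred (toℕ<n k)))
  x≤ : ∀ k → removeAt u last₁ k ≤ removeAt u mid₁ last₂
  x≤ k = subst (removeAt u last₁ k ≤_) (trans u-last (sym y-last)) (u≤ (punchIn last₁ k))
  pivot-arith : ∀ p t q m → suc (p + (suc t + q) + (p + t) + m) ≡ 2 * p + 2 * t + suc (suc q) + m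
  pivot-arith = solve-∀
  pivot₁ : suc (u last₁ + u mid₁ + m) ≡ 2 ^ e
  pivot₁ = trans (cong₂ (λ r s → suc (r + s + m)) u-last u-mid) (trans (pivot-arith p t q m) eq)
  pivot₂ : suc (removeAt u last₁ mid₂ + removeAt u mid₁ last₂ + m) ≡ 2 ^ e
  pivot₂ = trans (cong₂ (λ r s → suc (r + s + m)) x-mid y-last)
    (trans (cong (λ s → suc (s + m)) (+-comm (p + t) (p + (suc t + q)))) (trans (pivot-arith p t q m) eq))
  rest-rows : removeAt (removeAt u last₁) mid₂ ≗ gapᵛ p (suc t)
  rest-rows i = trans
    (cong (gap p t) (trans (toℕ-punchIn-fromℕ (punchIn mid₂ i)) (punchIn-mid₂ i)))
    (gap-gap p t (toℕ i))
  rest-columns : removeAt (removeAt u mid₁) last₂ ≗ gapᵛ p (suc t)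
  rest-columns i = trans
    (cong (gap p t) (trans (punchIn-mid₁ (punchIn last₂ i)) (cong (gap p 1) (toℕ-punchIn-fromℕ i))))
    (gap-gap p t (toℕ i))

-- The initial state of `strip`: the gap is empty, `gap p 0` is the identity, and the upper block
-- has `q = n - p` indices.
d-reflect : ∀ {m} → 1 ≤ m → ∀ p n e → p ≤ n → p + n + m ≡ 2 ^ e → d n m ≈± d p m
d-reflect {m} 1≤m p n e p≤n eq with q , refl ← m≤n⇒∃[o]m+o≡n p≤n =
  subst (λ k → d k m ≈± d p m) (+-comm q p)
    (subst (_≈± d p m) (det-hankel-cong {q + p} m (λ i → gap-0 p (toℕ i)) (λ i → gap-0 p (toℕ i)))
      (strip 1≤m p q 0 e (trans (arith p q m) eq)))
  where
  arith : ∀ p q m → 2 * p + 2 * 0 + q + m ≡ p + (p + q) + m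
  arith = solve-∀

-- Each value `v = i + j + m + 1` along the last row satisfies `v < 2 ^ e < 2 * v`, which no power
-- of two does.
d-vanish : ∀ m n e → 2 ^ e < 2 * (suc n + m) → 2 * suc n + m ≤ 2 ^ e → d (suc n) m ≡ 0ℤ
d-vanish m n e 2^e< ≤2^e = det-zero M last last (inj₁ λ k _ → last-row k) (last-row last)
  where
  M = hankel {suc n} m toℕ toℕ
  last = fromℕ n
  last-row : ∀ k → a (toℕ last + toℕ k + m) ≡ 0ℤ
  last-row k = a-nonpower λ (f , eq) → <⇒≱ (2^-cancel-< f e (f<e f eq)) (≤-pred (2^-cancel-< e (suc f) (e<1+f f eq)))
    where
    open ≤-Reasoning
    f<e : ∀ f → suc (toℕ last + toℕ k + m) ≡ 2 ^ f → 2 ^ f < 2 ^ e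
    f<e f eq = begin-strict
      2 ^ f                          ≡⟨ eq ⟨
      suc (toℕ last + toℕ k + m)     ≡⟨ cong (λ s → suc (s + toℕ k + m)) (toℕ-fromℕ n) ⟩
      suc (n + toℕ k + m)            ≤⟨ s≤s (+-monoˡ-≤ m (+-monoʳ-≤ n (≤-pred (toℕ<n k)))) ⟩
      suc (n + n + m)                <⟨ n<1+n _ ⟩
      2 + (n + n + m)                ≡⟨ arith n m ⟩
      2 * suc n + m                  ≤⟨ ≤2^e ⟩
      2 ^ e                          ∎
      where
      arith : ∀ n m → 2 + (n + n + m) ≡ 2 * suc n + m
      arith = solve-∀
    e<1+f : ∀ f → suc (toℕ last + toℕ k + m) ≡ 2 ^ f → 2 ^ e < 2 ^ suc f
    e<1+f f eq = begin-strict
      2 ^ e                                 <⟨ 2^e< ⟩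
      2 * (suc n + m)                       ≤⟨ *-monoʳ-≤ 2 (s≤s (+-monoˡ-≤ m (m≤m+n n (toℕ k)))) ⟩
      2 * suc (n + toℕ k + m)               ≡⟨ cong (λ s → 2 * suc (s + toℕ k + m)) (toℕ-fromℕ n) ⟨
      2 * suc (toℕ last + toℕ k + m)        ≡⟨ cong (2 *_) eq ⟩
      2 ^ suc f                             ∎

-- Residue classes

-- The congruences of the theorem as divisibility of natural numbers; the class of `- m` becomes
-- `N ∣ n + m`.
Residue : ℕ → ℕ → ℕ → Set
Residue N m n = N ∣ n ⊎ N ∣ n + m

residue-reflect : ∀ {N m} p n → N ∣ p + n + m → Residue N m n → Residue N m p
residue-reflect {N} {m} p n N∣ (inj₁ N∣n)  = inj₂ (∣m+n∣m⇒∣n (subst (N ∣_) (arith p n m) N∣) N∣n)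
  where
  arith : ∀ p n m → p + n + m ≡ n + (p + m)
  arith = solve-∀
residue-reflect {N} {m} p n N∣ (inj₂ N∣nm) = inj₁ (∣m+n∣m⇒∣n (subst (N ∣_) (arith p n m) N∣) N∣nm)
  where
  arith : ∀ p n m → p + n + m ≡ n + m + p
  arith = solve-∀

module _ (m K : ℕ) (2^K<m : 2 ^ K < m) (m≤2^1+K : m ≤ 2 ^ suc K) where

  private
    N : ℕ
    N = 2 ^ suc K

    1≤m : 1 ≤ m
    1≤m = ≤-trans (s≤s z≤n) 2^K<m

  -- Let `X` be half of `2 ^ (suc K + k)`. For `k > 0` it is a multiple of `N` with `n < X < n + m`.
  -- If `N` divided `n`, then `n + m ≤ n + N ≤ X`; if it divided `n + m`, then
  -- `2 * (X + N) ≤ 2 * (n + m) ≤ 2 * X + N`.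
  residue-free-gap : ∀ n k → 1 ≤ n → 2 ^ (suc K + k) < 2 * (n + m) → 2 * n + m ≤ 2 ^ (suc K + k) →
                     ¬ Residue N m n
  -- Here half of the power is `2 ^ K`, not a multiple of `N`; instead `0 < n ≤ n + m < N` leaves no
  -- room for a multiple.
  residue-free-gap n zero 1≤n _ ≤2^ residue = <⇒≱ n+m<N ([ (λ N∣n → ≤-trans (∣⇒≤ N∣n) (m≤m+n n m)) , ∣⇒≤ ]′ residue)
    where
    instance
      _ : NonZero n
      _ = >-nonZero 1≤n
      _ : NonZero (n + m)
      _ = >-nonZero (≤-trans 1≤n (m≤m+n n m))
    open ≤-Reasoning
    n+m<N : n + m < N
    n+m<N = begin-strict
      n + m                <⟨ +-monoˡ-≤ (n + m) 1≤n ⟩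
      n + (n + m)          ≡⟨ arith n m ⟩
      2 * n + m            ≤⟨ ≤2^ ⟩
      2 ^ (suc K + 0)      ≡⟨ cong (2 ^_) (+-identityʳ (suc K)) ⟩
      N                    ∎
      where
      arith : ∀ n m → n + (n + m) ≡ 2 * n + m
      arith = solve-∀
  residue-free-gap n (suc k) 1≤n 2^< ≤2^ = [ n-free , n+m-free ]′
    where
    open ≤-Reasoning
    X : ℕ
    X = 2 ^ (K + suc k)
    N∣X : N ∣ X
    N∣X = 2^-∣ (subst (suc K ≤_) (sym (+-suc K k)) (s≤s (m≤m+n K k)))
    X<n+m : X < n + m
    X<n+m = *-cancelˡ-< 2 X (n + m) 2^<
    n-free : ¬ N ∣ n
    n-free N∣n = <⇒≱ X<n+m (≤-trans (+-monoʳ-≤ n m≤2^1+K) (∣∧<⇒+≤ N∣n N∣X n<X))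
      where
      n<X : n < X
      n<X = *-cancelˡ-< 2 n X (<-≤-trans (m<m+n (2 * n) 1≤m) ≤2^)
    n+m-free : ¬ N ∣ n + m
    n+m-free N∣n+m = <⇒≱ (+-monoʳ-< (2 * (n + m)) (1≤2^ (suc K))) (begin
      2 * (n + m) + N        ≡⟨ arith₁ n m N ⟩
      2 * n + m + (m + N)    ≤⟨ +-mono-≤ ≤2^ (+-monoˡ-≤ N m≤2^1+K) ⟩
      2 * X + (N + N)        ≡⟨ arith₂ X N ⟩
      2 * (X + N)            ≤⟨ *-monoʳ-≤ 2 (∣∧<⇒+≤ N∣X N∣n+m X<n+m) ⟩
      2 * (n + m)            ≡⟨ +-identityʳ _ ⟨
      2 * (n + m) + 0        ∎)
      where
      arith₁ : ∀ n m N → 2 * (n + m) + N ≡ 2 * n + m + (m + N)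
      arith₁ = solve-∀
      arith₂ : ∀ X N → 2 * X + (N + N) ≡ 2 * (X + N)
      arith₂ = solve-∀

  d-residue : ∀ n → (Residue N m n → d n m ≈± 1ℤ) × (¬ Residue N m n → d n m ≡ 0ℤ)
  d-residue = <-rec _ step
    where
    step : ∀ n → (∀ {p} → p < n → (Residue N m p → d p m ≈± 1ℤ) × (¬ Residue N m p → d p m ≡ 0ℤ)) →
           (Residue N m n → d n m ≈± 1ℤ) × (¬ Residue N m n → d n m ≡ 0ℤ)
    step zero rec = (λ _ → inj₁ refl) , λ ¬residue → contradiction (inj₁ (N ∣0)) ¬residue
    step n@(suc n-1) rec with e , n+m≤2^e , 2^e< ← 2^-between (n + m) (s≤s z≤n)
      -- From `2 ^ K < m ≤ n + m ≤ 2 ^ e`; this makes `N` a divisor of `2 ^ e`.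
      with K<e ← 2^-cancel-< K e (<-≤-trans 2^K<m (≤-trans (m≤n+m m n) n+m≤2^e))
      -- Decides whether `2 ^ e` lies beyond the values `n + m, ..., 2 * n + m - 1` of the last row.
      with 2 * n + m ≤? 2 ^ e
    ... | yes ≤2^e with k , refl ← m≤n⇒∃[o]m+o≡n K<e =
      (λ residue → contradiction residue (residue-free-gap n k (s≤s z≤n) 2^e< ≤2^e)) ,
      (λ _ → d-vanish m n-1 e 2^e< ≤2^e)
    -- `p` is `2 ^ e - (n + m)`, smaller than `n` because `2 ^ e < 2 * n + m`.
    ... | no  ≰2^e with p , eq ← m≤n⇒∃[o]m+o≡n n+m≤2^e =
      (λ residue → ≈±-trans d≈± (proj₁ (rec p<n) (residue-reflect p n N∣sum residue))) ,
      -- The reflection is symmetric in `p` and `n`, so a residue of `p` would give one of `n`.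
      (λ ¬residue → vanish d≈± (proj₂ (rec p<n)
        (¬residue ∘ residue-reflect n p (subst (N ∣_) (cong (_+ m) (+-comm p n)) N∣sum))))
      where
      sum≡2^e : p + n + m ≡ 2 ^ e
      sum≡2^e = trans (arith p n m) eq
        where
        arith : ∀ p n m → p + n + m ≡ n + m + p
        arith = solve-∀
      N∣sum : N ∣ p + n + m
      N∣sum = subst (N ∣_) (sym sum≡2^e) (2^-∣ K<e)
      p<n : p < n
      p<n = +-cancelˡ-< (n + m) p n (subst₂ _<_ (sym eq) (arith n m) (≰⇒> ≰2^e))
        where
        arith : ∀ n m → 2 * n + m ≡ n + m + n
        arith = solve-∀
      d≈± : d n m ≈± d p m
      d≈± = d-reflect 1≤m p n e (<⇒≤ p<n) sum≡2^e
      vanish : ∀ {x y} → x ≈± y → y ≡ 0ℤ → x ≡ 0ℤ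
      vanish (inj₁ x≡y)  y≡0 = trans x≡y y≡0
      vanish (inj₂ x≡-y) y≡0 = trans x≡-y (cong -_ y≡0)

theorem3p1 : ∀ (m K : ℕ) → 1 ≤ 2 ^ K → 2 ^ K < m → m ≤ 2 ^ suc K → ∀ (n : ℕ) →
    ((+ n ≡ + 0 [mod 2 ^ suc K ] ⊎ + n ≡ - (+ m) [mod 2 ^ suc K ]) → (d n m ≡ 1ℤ ⊎ d n m ≡ -1ℤ)) ×
    (¬ (+ n ≡ + 0 [mod 2 ^ suc K ] ⊎ + n ≡ - (+ m) [mod 2 ^ suc K ]) → d n m ≡ 0ℤ)
theorem3p1 m@(suc _) K _ 2^K<m m≤2^1+K n =
  -- With `m` a successor, the double negation of `+ m` computes and the second congruence is
  -- `2 ^ suc K ∣ n + m` by definition; the first unfolds to divisibility of `n + 0`.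
  (λ congruence → proj₁ (d-residue m K 2^K<m m≤2^1+K n)
    (Sum.map₁ (subst (2 ^ suc K ∣_) (+-identityʳ n)) congruence)) ,
  (λ ¬congruence → proj₂ (d-residue m K 2^K<m m≤2^1+K n)
    (¬congruence ∘ Sum.map₁ (subst (2 ^ suc K ∣_) (sym (+-identityʳ n)))))
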